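{- Let $x$ be transcendental over $\mathbb{Q}$ and let $y$ be a solution of $$y^5+5y^3+5y-11=\frac{(x-1)^5}{x^4+x^3+6x^2+6x+11}.\qquad (\mathrm{E})$$ Let $v$ satisfy $1/v-v=x$. Then the function field $\mathbb{Q}(v,y)$ contains a solution $w$ of $1/w-w=y$ such that $$w^5=v\,\frac{v^4-3v^3+4v^2-2v+1}{v^4+2v^3+4v^2+3v+1}.$$ Consequently, the tower over $\mathbb{Q}$ defined recursively by $$y^5=x\,\frac{x^4-3x^3+4x^2-2x+1}{x^4+2x^3+4x^2+3x+1}\qquad(\mathrm{L})$$ is a supertower of the tower of function fields of the classical modular curves $(X_0(5^n))_{n\ge2}$; that is, the fields $\mathbb{Q}(v_0,\dots,v_n)$, where each pair $(x,y)=(v_i,v_{i+1})$ satisfies (L), contain as subfields the fields $\mathbb{Q}(x_0,\dots,x_n)$, with $x_i=1/v_i-v_i$, of the recursive tower in which each pair $(x,y)=(x_i,x_{i+1})$ satisfies (E).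
   Context: A tower of function fields is said to satisfy a recursive equation $f(x,y)=0$ if its $n$-th field is generated over the constant field by elements $x_0,\dots,x_n$ with $x_0$ transcendental and $f(x_i,x_{i+1})=0$ for $0\le i<n$. By a result of Elkies, the tower of function fields over $\mathbb{Q}$ of the classical modular curves $(X_0(5^n))_{n\ge 2}$ satisfies the recursive equation (E), which is equivalent to $P(y)=125/P\left(\frac{x+4}{x-1}\right)$ with $P(t)=t^5+5t^3+5t-11$. -}

module Defs where

open import Level using (Level; _⊔_; suc)
open import Algebra.Bundles using (CommutativeRing; Semiring)
open import Algebra.Morphism.Structures using (IsRingHomomorphism)
open import Data.List.Base using (List; []; _∷_)
open import Data.List.Relation.Unary.Any using (Any)
open import Data.Nat.Base using (ℕ; _≤_) renaming (suc to 1+_)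
open import Data.Product.Base using (Σ-syntax; ∃-syntax; _×_)
open import Data.Rational.Base using (ℚ; 0ℚ; +-*-rawRing)
open import Data.Sum.Base using (_⊎_)
open import Relation.Binary.Core using (Rel)
open import Relation.Binary.PropositionalEquality.Core using (_≢_)
open import Relation.Nullary.Negation.Core using (¬_)
open import Relation.Unary using (Pred; _∈_; _⊆_; _≐_)

-- Fields in the classical sense: every element that is not zero is
-- invertible.  (The library's HeytingField inverts only elements apart from
-- zero for an additional apartness relation.)  Equality is not assumed to be
-- decidable.  Division takes a proof that the denominator is nonzero, so
-- there are no junk values.
record Field c ℓ : Set (suc (c ⊔ ℓ)) where
  field
    commutativeRing : CommutativeRing c ℓ
  open CommutativeRing commutativeRing public
  field
    0≉1      : 0# ≉ 1#
    inv      : ∀ a → a ≉ 0# → Carrier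
    inverseʳ : ∀ a (a≉0 : a ≉ 0#) → a * inv a a≉0 ≈ 1#

  infix 7 _/_[_]
  _/_[_] : ∀ a b → b ≉ 0# → Carrier
  a / b [ b≉0 ] = a * inv b b≉0

-- A ring homomorphism out of ℚ into a field is automatically injective.
record FieldExtensionOfℚ c ℓ : Set (suc (c ⊔ ℓ)) where
  field
    base : Field c ℓ
  open Field base public
  field
    ι                    : ℚ → Carrier
    ι-isRingHomomorphism :
      IsRingHomomorphism +-*-rawRing (CommutativeRing.rawRing commutativeRing) ι

module OverℚIn {c ℓ : Level} (K : FieldExtensionOfℚ c ℓ) where

  open FieldExtensionOfℚ K public
  open import Algebra.Definitions.RawSemiring
    (Semiring.rawSemiring semiring) public
    using (_^_) renaming (_×_ to _·_)

  -- Polynomials over ℚ are coefficient lists, constant term first; trailing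
  -- zeros are allowed.
  eval : List ℚ → Carrier → Carrier
  eval []      a = 0#
  eval (q ∷ p) a = ι q + a * eval p a

  NonZeroPolynomial : List ℚ → Set
  NonZeroPolynomial = Any (_≢ 0ℚ)

  Transcendental : Carrier → Set ℓ
  Transcendental a = ∀ p → NonZeroPolynomial p → eval p a ≉ 0#

  -- The smallest subfield of K containing ℚ and S.
  data ℚ⟨_⟩ {s} (S : Pred Carrier s) : Pred Carrier (c ⊔ ℓ ⊔ s) where
    gen   : ∀ {a} → a ∈ S → a ∈ ℚ⟨ S ⟩
    const : ∀ q → ι q ∈ ℚ⟨ S ⟩
    add   : ∀ {a b} → a ∈ ℚ⟨ S ⟩ → b ∈ ℚ⟨ S ⟩ → a + b ∈ ℚ⟨ S ⟩
    neg   : ∀ {a} → a ∈ ℚ⟨ S ⟩ → - a ∈ ℚ⟨ S ⟩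
    mul   : ∀ {a b} → a ∈ ℚ⟨ S ⟩ → b ∈ ℚ⟨ S ⟩ → a * b ∈ ℚ⟨ S ⟩
    recip : ∀ {a} (a≉0 : a ≉ 0#) → a ∈ ℚ⟨ S ⟩ → inv a a≉0 ∈ ℚ⟨ S ⟩
    resp  : ∀ {a b} → a ≈ b → a ∈ ℚ⟨ S ⟩ → b ∈ ℚ⟨ S ⟩

  ℚ[_,_] : Carrier → Carrier → Pred Carrier (c ⊔ ℓ)
  ℚ[ a , b ] = ℚ⟨ (λ e → e ≈ a ⊎ e ≈ b) ⟩

  ℚ[_]≤_ : (ℕ → Carrier) → ℕ → Pred Carrier (c ⊔ ℓ)
  ℚ[ x ]≤ n = ℚ⟨ (λ e → ∃[ i ] (i ≤ n × e ≈ x i)) ⟩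

  -- The tower F (a sequence of subfields of K) satisfies the recursive
  -- equation R, with x₀, x₁, … as the generating elements.
  record RecursiveTower (R : Rel Carrier ℓ) (x : ℕ → Carrier)
                        (F : ℕ → Pred Carrier (c ⊔ ℓ)) : Set (c ⊔ ℓ) where
    field
      transcendental : Transcendental (x 0)
      recursion      : ∀ i → R (x i) (x (1+ i))
      generated      : ∀ n → F n ≐ ℚ[ x ]≤ n

  _IsSupertowerOf_ : (G F : ℕ → Pred Carrier (c ⊔ ℓ)) → Set (c ⊔ ℓ)
  G IsSupertowerOf F = ∀ n → F n ⊆ G n

  -- In the following equations the nonvanishing of each denominator is part
  -- of the assertion that the equation holds; n · a is the n-fold sum of a.

  denE numL denL : Carrier → Carrier
  denE x = x ^ 4 + x ^ 3 + 6 · x ^ 2 + 6 · x + 11 · 1#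
  numL x = x ^ 4 - 3 · x ^ 3 + 4 · x ^ 2 - 2 · x + 1#
  denL x = x ^ 4 + 2 · x ^ 3 + 4 · x ^ 2 + 3 · x + 1#

  EqE : Rel Carrier ℓ
  EqE x y = Σ[ d≉0 ∈ denE x ≉ 0# ]
    y ^ 5 + 5 · y ^ 3 + 5 · y - 11 · 1# ≈ (x - 1#) ^ 5 / denE x [ d≉0 ]

  EqL : Rel Carrier ℓ
  EqL x y = Σ[ d≉0 ∈ denL x ≉ 0# ]
    y ^ 5 ≈ x * (numL x / denL x [ d≉0 ])

  1/_-self≈_ : Rel Carrier ℓ
  1/ v -self≈ x = Σ[ v≉0 ∈ v ≉ 0# ] 1# / v [ v≉0 ] - v ≈ x

module Submission where

-- The algebra.  Write N(v) and L(v) for the numerator and denominator in (L),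
-- and d(x) for the denominator in (E).  If x = 1/v - v, then
-- v⁴ d(x) = N(v) L(v) (denE-factors) and
-- v⁵ (x - 1)⁵ = L(v)² - v² N(v)² - 11 v N(v) L(v) (numE-factors).  Hence, for
-- u = v N(v)/L(v), the right-hand side of (E) is 1/u - u - 11 (rhsE-rhsL).
-- If y = 1/w - w, the left-hand side of (E) is 1/w⁵ - w⁵ - 11
-- (lhsE-fifthPower).  So w⁵ = u implies (E).  Conversely, (E) says that u and
-- the fifth power of a root w of w² + y w - 1 satisfy the same quadratic
-- equation, so u is the fifth power of one of the two roots.  Reducing w⁵
-- modulo w² + y w - 1 gives (y⁴ + 3 y² + 1) w - (y³ + 2 y), and therefore that
-- root is w = (u + y³ + 2 y)/(y⁴ + 3 y² + 1), an element of ℚ(v, y).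
--
-- The denominators.  That y⁴ + 3 y² + 1 and N(v) do not vanish, at every level
-- of a tower, follows from transcendence, which therefore has to be carried
-- along the towers.  Cleared of denominators, (E) is monic in x with
-- coefficients in ℚ[y], (L) is monic in v with coefficients in ℚ[w], and
-- v² + x v - 1 = 0 is monic in v with coefficients in ℚ[x].  If x is integral
-- over ℚ[y] and x is transcendental, so is y (integral⇒transcendental):
-- otherwise finitely many products yⁱ xʲ span a ℚ-space that is closed under
-- multiplication by x, and more powers of x than its number of generators are
-- linearly dependent.  For the passage from x to v at the bottom of a tower
-- the same count is applied to vⁿ, vⁿ x, ..., vⁿ xⁿ (↝⇒transcendental).
-- Equality in K need not be decidable, but elimination only inspects rational
-- coefficients, and transcendence is a negative statement.

open import Defs
open import Algebra.Morphism.Structures using (module RingMorphisms)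
import Algebra.Properties.Ring as RingProperties
import Algebra.Properties.Semiring.Exp as Exp
import Algebra.Properties.Semiring.Mult as Mult
import Algebra.Properties.Semiring.Sum as Sum
import Algebra.Solver.Ring as RingSolver
open import Algebra.Solver.Ring.AlmostCommutativeRing
  using (_-Raw-AlmostCommutative⟶_; fromCommutativeRing)
open import Data.Fin.Base using (Fin; zero; suc; toℕ; punchIn; combine; remQuot)
open import Data.Fin.Properties using (any?; remQuot-combine)
open import Data.List.Base using ([]; _∷_; tabulate)
import Data.List.Relation.Unary.Any as Any
open import Data.List.Relation.Unary.Any using (here; there)
open import Data.List.Relation.Unary.Any.Properties using (tabulate⁺)
import Data.Maybe.Base as Maybe
open import Data.Nat.Base as ℕ using (ℕ; zero; suc; _≤_; z≤n; s≤s)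
open import Data.Product.Base using (Σ-syntax; ∃-syntax; _×_; _,_; proj₁; proj₂; uncurry)
import Data.Rational.Base as ℚ
open import Data.Rational.Base using (ℚ; 0ℚ; 1ℚ)
import Data.Rational.Properties as ℚ
open import Data.Sum.Base using (_⊎_; inj₁; inj₂)
open import Data.Vec.Base using (Vec; []; _∷_; lookup)
open import Data.Vec.Functional using (insertAt)
open import Data.Vec.Functional.Properties using (insertAt-lookup; insertAt-punchIn)
open import Data.Vec.Relation.Unary.All using (All; []; _∷_)
import Data.Vec.Relation.Unary.All.Properties as All
open import Function.Base using (_∘_)
open import Level using (_⊔_)
open import Relation.Binary.PropositionalEquality.Core as ≡ using (_≡_; _≢_)
import Relation.Binary.Reasoning.Setoid as SetoidReasoning
open import Relation.Nullary.Decidable using (yes; no; ¬?; dec⇒maybe; decidable-stable)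
open import Relation.Nullary.Negation using (¬_; contradiction)
open import Relation.Unary using (Pred; _∈_; _⊆_)

-- Rationals and finite indices

-- Among finitely many rationals there is one of which all are multiples.
pivot : ∀ {n} (q : Fin (suc n) → ℚ) →
  ∃[ j ] Σ[ r ∈ (Fin (suc n) → ℚ) ] (∀ i → q i ℚ.+ r i ℚ.* q j ≡ 0ℚ)
pivot q with any? (λ i → ¬? (q i ℚ.≟ 0ℚ))
... | no ∄ = zero , (λ _ → 0ℚ) , λ i →
  ≡.trans (≡.cong (q i ℚ.+_) (ℚ.*-zeroˡ (q zero)))
  (≡.trans (ℚ.+-identityʳ (q i))
  (decidable-stable (q i ℚ.≟ 0ℚ) (λ qᵢ≢0 → ∄ (i , qᵢ≢0))))
... | yes (j , qⱼ≢0) = j , (λ i → ℚ.- (q i ℚ.* ℚ.1/ q j)) , λ i →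
  ≡.trans (≡.cong (q i ℚ.+_) (≡.trans (≡.sym (ℚ.neg-distribˡ-* (q i ℚ.* ℚ.1/ q j) (q j)))
    (≡.cong ℚ.-_ (≡.trans (ℚ.*-assoc (q i) (ℚ.1/ q j) (q j))
      (≡.trans (≡.cong (q i ℚ.*_) (ℚ.*-inverseˡ (q j))) (ℚ.*-identityʳ (q i)))))))
  (ℚ.+-inverseʳ (q i))
  where instance _ = ℚ.≢-nonZero qⱼ≢0

-- The successor of an index below n is again an index below n, or n itself.
successor : ∀ {n} (i : Fin n) → (∃[ j ] suc (toℕ i) ≡ toℕ {n} j) ⊎ suc (toℕ i) ≡ n
successor {suc zero}    zero = inj₂ ≡.refl
successor {suc (suc n)} zero = inj₁ (suc zero , ≡.refl)
successor (suc i) with successor i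
... | inj₁ (j , eq) = inj₁ (suc j , ≡.cong suc eq)
... | inj₂ eq       = inj₂ (≡.cong suc eq)

module Extension {c ℓ} (K : FieldExtensionOfℚ c ℓ) where

  open OverℚIn K hiding (zero)
  open RingProperties ring using (-1*x≈-x)
  open Exp semiring using (^-congˡ)
  open Mult semiring using (×-congʳ)
  open Sum semiring using (sum; sum-cong-≋; sum-remove; *-distribˡ-sum)
  open SetoidReasoning setoid
  private module ι = RingMorphisms.IsRingHomomorphism ι-isRingHomomorphism

  -- Solving ring equations with rational coefficients

  -- A copy of ι that computes to 0# and 1# at 0 and 1, so that the ring
  -- solver with rational coefficients recognises these constants.
  ι′ : ℚ → Carrier
  ι′ q with q ℚ.≟ 0ℚ | q ℚ.≟ 1ℚ
  ... | yes _ | _     = 0#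
  ... | no  _ | yes _ = 1#
  ... | no  _ | no _  = ι q

  ι′≈ι : ∀ q → ι′ q ≈ ι q
  ι′≈ι q with q ℚ.≟ 0ℚ | q ℚ.≟ 1ℚ
  ... | yes ≡.refl | _          = sym ι.0#-homo
  ... | no  _      | yes ≡.refl = sym ι.1#-homo
  ... | no  _      | no _       = refl

  coefficients : ℚ.+-*-rawRing -Raw-AlmostCommutative⟶ fromCommutativeRing commutativeRing
  coefficients = record
    { ⟦_⟧    = ι′
    ; +-homo = λ p q → trans (ι′≈ι _) (trans (ι.+-homo p q) (sym (+-cong (ι′≈ι p) (ι′≈ι q))))
    ; *-homo = λ p q → trans (ι′≈ι _) (trans (ι.*-homo p q) (sym (*-cong (ι′≈ι p) (ι′≈ι q))))
    ; -‿homo = λ p → trans (ι′≈ι _) (trans (ι.-‿homo p) (sym (-‿cong (ι′≈ι p))))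
    ; 0-homo = refl
    ; 1-homo = refl
    }

  open RingSolver ℚ.+-*-rawRing (fromCommutativeRing commutativeRing) coefficients
    (λ p q → Maybe.map (λ p≡q → reflexive (≡.cong ι′ p≡q)) (dec⇒maybe (p ℚ.≟ q)))

  -- An identity that holds up to a multiple of p - q holds when p ≈ q.
  modulo : ∀ {a b p q} k → p ≈ q → a ≈ b + (p - q) * k → a ≈ b
  modulo {a} {b} {p} {q} k p≈q a≈ = begin
    a                  ≈⟨ a≈ ⟩
    b + (p - q) * k    ≈⟨ +-congˡ (*-congʳ (+-congʳ p≈q)) ⟩
    b + (q - q) * k    ≈⟨ solve 3 (λ b q k → b :+ (q :- q) :* k := b) refl b q k ⟩
    b                  ∎

  -- Nonzero elements and division

  *-cancelˡ-≉0 : ∀ {z a b} → z ≉ 0# → z * a ≈ z * b → a ≈ b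
  *-cancelˡ-≉0 {z} {a} {b} z≉0 za≈zb = begin
    a                    ≈⟨ unit a ⟩
    inv z z≉0 * (z * a)  ≈⟨ *-congˡ za≈zb ⟩
    inv z z≉0 * (z * b)  ≈⟨ unit b ⟨
    b                    ∎
    where
    unit : ∀ a → a ≈ inv z z≉0 * (z * a)
    unit a = begin
      a                    ≈⟨ *-identityˡ a ⟨
      1# * a               ≈⟨ *-congʳ (inverseʳ z z≉0) ⟨
      z * inv z z≉0 * a    ≈⟨ solve 3 (λ z i a → z :* i :* a := i :* (z :* a)) refl z (inv z z≉0) a ⟩
      inv z z≉0 * (z * a)  ∎

  *-≉0 : ∀ {a b} → a ≉ 0# → b ≉ 0# → a * b ≉ 0#
  *-≉0 a≉0 b≉0 ab≈0 = b≉0 (*-cancelˡ-≉0 a≉0 (trans ab≈0 (sym (zeroʳ _))))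

  ^-≉0 : ∀ {a} n → a ≉ 0# → a ^ n ≉ 0#
  ^-≉0 zero    a≉0 = 0≉1 ∘ sym
  ^-≉0 (suc n) a≉0 = *-≉0 a≉0 (^-≉0 n a≉0)

  *-≉0⁻ˡ : ∀ {a b} → a * b ≉ 0# → a ≉ 0#
  *-≉0⁻ˡ ab≉0 a≈0 = ab≉0 (trans (*-congʳ a≈0) (zeroˡ _))

  *-≉0⁻ʳ : ∀ {a b} → a * b ≉ 0# → b ≉ 0#
  *-≉0⁻ʳ ab≉0 b≈0 = ab≉0 (trans (*-congˡ b≈0) (zeroʳ _))

  ≈-≉0 : ∀ {a b} → a ≈ b → b ≉ 0# → a ≉ 0#
  ≈-≉0 a≈b b≉0 a≈0 = b≉0 (trans (sym a≈b) a≈0)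

  /-*-cancel : ∀ a {d} (d≉0 : d ≉ 0#) → (a / d [ d≉0 ]) * d ≈ a
  /-*-cancel a {d} d≉0 = begin
    a * inv d d≉0 * d    ≈⟨ solve 3 (λ a i d → a :* i :* d := a :* (d :* i)) refl a (inv d d≉0) d ⟩
    a * (d * inv d d≉0)  ≈⟨ *-congˡ (inverseʳ d d≉0) ⟩
    a * 1#               ≈⟨ *-identityʳ a ⟩
    a                    ∎

  ≈/⇒*≈ : ∀ {a b d} (d≉0 : d ≉ 0#) → a ≈ b / d [ d≉0 ] → a * d ≈ b
  ≈/⇒*≈ d≉0 a≈b/d = trans (*-congʳ a≈b/d) (/-*-cancel _ d≉0)

  *≈⇒≈/ : ∀ {a b d} (d≉0 : d ≉ 0#) → a * d ≈ b → a ≈ b / d [ d≉0 ]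
  *≈⇒≈/ {a} {b} {d} d≉0 ad≈b = *-cancelˡ-≉0 d≉0 (begin
    d * a                ≈⟨ *-comm d a ⟩
    a * d                ≈⟨ ad≈b ⟩
    b                    ≈⟨ /-*-cancel b d≉0 ⟨
    b / d [ d≉0 ] * d    ≈⟨ *-comm _ d ⟩
    d * (b / d [ d≉0 ])  ∎)

  -- Linear dependence over ℚ

  -- The ℚ-subspace of K spanned by a finite family.
  data Span {n} (e : Fin n → Carrier) : Pred Carrier (c ⊔ ℓ) where
    gen   : ∀ i → e i ∈ Span e
    null  : 0# ∈ Span e
    add   : ∀ {a b} → a ∈ Span e → b ∈ Span e → a + b ∈ Span e
    scale : ∀ q {a} → a ∈ Span e → ι q * a ∈ Span e
    resp  : ∀ {a b} → a ≈ b → a ∈ Span e → b ∈ Span e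

  span-neg : ∀ {n} {e : Fin n → Carrier} {a} → a ∈ Span e → - a ∈ Span e
  span-neg {a = a} a∈ = resp ι[-1]*a≈-a (scale (ℚ.- 1ℚ) a∈)
    where
    ι[-1]*a≈-a : ι (ℚ.- 1ℚ) * a ≈ - a
    ι[-1]*a≈-a = trans (*-congʳ (trans (ι.-‿homo 1ℚ) (-‿cong ι.1#-homo))) (-1*x≈-x a)

  span-sum : ∀ {n} {e : Fin n → Carrier} k (f : Fin k → Carrier) →
    (∀ i → f i ∈ Span e) → sum f ∈ Span e
  span-sum zero    f f∈ = null
  span-sum (suc k) f f∈ = add (f∈ zero) (span-sum k (f ∘ suc) (f∈ ∘ suc))

  -- Multiplication by s is ℚ-linear, so it is enough to know it on generators.
  span-mul : ∀ {m n} {e : Fin m → Carrier} {e′ : Fin n → Carrier} s →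
    (∀ i → s * e i ∈ Span e′) → ∀ {a} → a ∈ Span e → s * a ∈ Span e′
  span-mul s h (gen i)     = h i
  span-mul s h null        = resp (sym (zeroʳ s)) null
  span-mul s h (add a b)   = resp (sym (distribˡ s _ _)) (add (span-mul s h a) (span-mul s h b))
  span-mul s h (scale q a) = resp
    (solve 3 (λ q s a → q :* (s :* a) := s :* (q :* a)) refl (ι q) s _)
    (scale q (span-mul s h a))
  span-mul s h (resp eq a) = resp (*-congˡ eq) (span-mul s h a)

  span-∅ : ∀ {e : Fin 0 → Carrier} {a} → a ∈ Span e → a ≈ 0#
  span-∅ null         = refl
  span-∅ (add a b)    = trans (+-cong (span-∅ a) (span-∅ b)) (+-identityˡ 0#)
  span-∅ (scale q a)  = trans (*-congˡ (span-∅ a)) (zeroʳ (ι q))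
  span-∅ (resp a≈b a) = trans (sym a≈b) (span-∅ a)

  -- Splitting off the coefficient of the first generator.
  span-uncons : ∀ {n} {e : Fin (suc n) → Carrier} {a} → a ∈ Span e →
    ∃[ q ] ∃[ b ] (b ∈ Span (e ∘ suc) × a ≈ ι q * e zero + b)
  span-uncons {e = e} (gen zero) = 1ℚ , 0# , null , (begin
    e zero              ≈⟨ *-identityˡ _ ⟨
    1# * e zero         ≈⟨ *-congʳ ι.1#-homo ⟨
    ι 1ℚ * e zero       ≈⟨ +-identityʳ _ ⟨
    ι 1ℚ * e zero + 0#  ∎)
  span-uncons {e = e} (gen (suc i)) = 0ℚ , e (suc i) , gen i , (begin
    e (suc i)                     ≈⟨ solve 2 (λ a b → b := con 0ℚ :* a :+ b) refl (e zero) (e (suc i)) ⟩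
    0# * e zero + e (suc i)       ≈⟨ +-congʳ (*-congʳ ι.0#-homo) ⟨
    ι 0ℚ * e zero + e (suc i)     ∎)
  span-uncons {e = e} null = 0ℚ , 0# , null , (begin
    0#                   ≈⟨ solve 1 (λ a → con 0ℚ := con 0ℚ :* a :+ con 0ℚ) refl (e zero) ⟩
    0# * e zero + 0#     ≈⟨ +-congʳ (*-congʳ ι.0#-homo) ⟨
    ι 0ℚ * e zero + 0#   ∎)
  span-uncons {e = e} (add {a} {a′} a∈ a′∈) with span-uncons a∈ | span-uncons a′∈
  ... | q , b , b∈ , a≈ | q′ , b′ , b′∈ , a′≈ = q ℚ.+ q′ , b + b′ , add b∈ b′∈ , (begin
    a + a′                                     ≈⟨ +-cong a≈ a′≈ ⟩
    ι q * e zero + b + (ι q′ * e zero + b′)    ≈⟨ solve 5 (λ q q′ e b b′ →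
      q :* e :+ b :+ (q′ :* e :+ b′) := (q :+ q′) :* e :+ (b :+ b′)) refl (ι q) (ι q′) (e zero) b b′ ⟩
    (ι q + ι q′) * e zero + (b + b′)           ≈⟨ +-congʳ (*-congʳ (ι.+-homo q q′)) ⟨
    ι (q ℚ.+ q′) * e zero + (b + b′)           ∎)
  span-uncons {e = e} (scale p {a} a∈) with span-uncons a∈
  ... | q , b , b∈ , a≈ = p ℚ.* q , ι p * b , scale p b∈ , (begin
    ι p * a                           ≈⟨ *-congˡ a≈ ⟩
    ι p * (ι q * e zero + b)          ≈⟨ solve 4 (λ p q e b →
      p :* (q :* e :+ b) := p :* q :* e :+ p :* b) refl (ι p) (ι q) (e zero) b ⟩
    ι p * ι q * e zero + ι p * b      ≈⟨ +-congʳ (*-congʳ (ι.*-homo p q)) ⟨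
    ι (p ℚ.* q) * e zero + ι p * b    ∎)
  span-uncons (resp a≈a′ a∈) with span-uncons a∈
  ... | q , b , b∈ , a≈ = q , b , b∈ , trans (sym a≈a′) a≈

  -- Adding multiples of a fixed element a to the terms of a linear combination
  -- adds a multiple of a to its value.
  sum-shift : ∀ n (γ r : Fin n → ℚ) (f : Fin n → Carrier) a →
    ∃[ s ] sum (λ i → ι (γ i) * (f i + ι (r i) * a)) ≈ sum (λ i → ι (γ i) * f i) + ι s * a
  sum-shift zero γ r f a = 0ℚ , (begin
    0#              ≈⟨ solve 1 (λ a → con 0ℚ := con 0ℚ :+ con 0ℚ :* a) refl a ⟩
    0# + 0# * a     ≈⟨ +-congˡ (*-congʳ ι.0#-homo) ⟨
    0# + ι 0ℚ * a   ∎)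
  sum-shift (suc n) γ r f a with sum-shift n (γ ∘ suc) (r ∘ suc) (f ∘ suc) a
  ... | s , eq = γ zero ℚ.* r zero ℚ.+ s , (begin
    ι (γ zero) * (f zero + ι (r zero) * a) + _
      ≈⟨ +-congˡ eq ⟩
    ι (γ zero) * (f zero + ι (r zero) * a) + (S + ι s * a)
      ≈⟨ solve 6 (λ g r s f a S → g :* (f :+ r :* a) :+ (S :+ s :* a)
                    := g :* f :+ S :+ (g :* r :+ s) :* a)
           refl (ι (γ zero)) (ι (r zero)) (ι s) (f zero) a S ⟩
    ι (γ zero) * f zero + S + (ι (γ zero) * ι (r zero) + ι s) * a
      ≈⟨ +-congˡ (*-congʳ (trans (ι.+-homo _ s) (+-congʳ (ι.*-homo (γ zero) (r zero))))) ⟨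
    ι (γ zero) * f zero + S + ι (γ zero ℚ.* r zero ℚ.+ s) * a
      ∎)
    where S = sum (λ i → ι (γ (suc i)) * f (suc i))

  -- More than n elements of a space spanned by n elements are dependent:
  -- one of them serves to clear the coefficients of the first generator.
  dependent : ∀ n {e : Fin n → Carrier} (f : Fin (suc n) → Carrier) → (∀ i → f i ∈ Span e) →
    Σ[ γ ∈ (Fin (suc n) → ℚ) ] (∃[ k ] γ k ≢ 0ℚ) × sum (λ i → ι (γ i) * f i) ≈ 0#
  dependent zero f f∈ = (λ _ → 1ℚ) , (zero , λ ()) , (begin
    ι 1ℚ * f zero + 0#  ≈⟨ +-identityʳ _ ⟩
    ι 1ℚ * f zero       ≈⟨ *-congˡ (span-∅ (f∈ zero)) ⟩
    ι 1ℚ * 0#           ≈⟨ zeroʳ _ ⟩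
    0#                  ∎)
  dependent (suc n) {e} f f∈ with pivot (λ i → proj₁ (span-uncons (f∈ i)))
  ... | j , r , cleared = γ , (punchIn j k , γ-punchIn≢0) , (begin
      sum (λ i → ι (γ i) * f i)
        ≈⟨ sum-remove {i = j} (λ i → ι (γ i) * f i) ⟩
      ι (γ j) * f j + sum (λ i → ι (γ (punchIn j i)) * f (punchIn j i))
        ≈⟨ +-cong (*-congʳ (reflexive (≡.cong ι (insertAt-lookup γ′ j s))))
             (sum-cong-≋ {suc n} (λ i → *-congʳ {f (punchIn j i)} (reflexive (≡.cong ι (insertAt-punchIn γ′ j s i))))) ⟩
      ι s * f j + sum (λ i → ι (γ′ i) * f (punchIn j i))
        ≈⟨ +-comm _ _ ⟩
      sum (λ i → ι (γ′ i) * f (punchIn j i)) + ι s * f j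
        ≈⟨ shift ⟨
      sum (λ i → ι (γ′ i) * h i)
        ≈⟨ vanishes ⟩
      0#
        ∎)
    where
    h : Fin (suc n) → Carrier
    h i = f (punchIn j i) + ι (r (punchIn j i)) * f j
    h∈ : ∀ i → h i ∈ Span (e ∘ suc)
    h∈ i with span-uncons (f∈ (punchIn j i)) | span-uncons (f∈ j) | cleared (punchIn j i)
    ... | q , b , b∈ , f≈ | q′ , b′ , b′∈ , fⱼ≈ | q+rq′≡0 =
      resp (sym (begin
        f (punchIn j i) + ι ρ * f j
          ≈⟨ +-cong f≈ (*-congˡ fⱼ≈) ⟩
        ι q * e zero + b + ι ρ * (ι q′ * e zero + b′)
          ≈⟨ solve 6 (λ q q′ ρ e b b′ → q :* e :+ b :+ ρ :* (q′ :* e :+ b′)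
                        := (q :+ ρ :* q′) :* e :+ (b :+ ρ :* b′))
               refl (ι q) (ι q′) (ι ρ) (e zero) b b′ ⟩
        (ι q + ι ρ * ι q′) * e zero + (b + ι ρ * b′)
          ≈⟨ +-congʳ (*-congʳ (trans (ι.+-homo q _) (+-congˡ (ι.*-homo ρ q′)))) ⟨
        ι (q ℚ.+ ρ ℚ.* q′) * e zero + (b + ι ρ * b′)
          ≈⟨ +-congʳ (*-congʳ (trans (reflexive (≡.cong ι q+rq′≡0)) ι.0#-homo)) ⟩
        0# * e zero + (b + ι ρ * b′)
          ≈⟨ solve 2 (λ e b → con 0ℚ :* e :+ b := b) refl (e zero) _ ⟩
        b + ι ρ * b′
          ∎))
      (add b∈ (scale ρ b′∈))
      where ρ = r (punchIn j i)
    rec = dependent n h h∈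
    γ′ = proj₁ rec
    k = proj₁ (proj₁ (proj₂ rec))
    vanishes = proj₂ (proj₂ rec)
    shifted = sum-shift (suc n) γ′ (λ i → r (punchIn j i)) (λ i → f (punchIn j i)) (f j)
    s = proj₁ shifted
    shift = proj₂ shifted
    γ = insertAt γ′ j s
    γ-punchIn≢0 : γ (punchIn j k) ≢ 0ℚ
    γ-punchIn≢0 γ≡0 = proj₂ (proj₁ (proj₂ rec)) (≡.trans (≡.sym (insertAt-punchIn γ′ j s k)) γ≡0)

  -- Transcendental elements

  eval-tabulate : ∀ n (γ : Fin n → ℚ) a m →
    m * eval (tabulate γ) a ≈ sum (λ i → ι (γ i) * (m * a ^ toℕ i))
  eval-tabulate zero    γ a m = zeroʳ m
  eval-tabulate (suc n) γ a m = begin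
    m * (ι (γ zero) + a * E)
      ≈⟨ solve 4 (λ m g a E → m :* (g :+ a :* E) := g :* (m :* con 1ℚ) :+ (m :* a) :* E)
           refl m (ι (γ zero)) a E ⟩
    ι (γ zero) * (m * 1#) + m * a * E
      ≈⟨ +-congˡ (eval-tabulate n (γ ∘ suc) a (m * a)) ⟩
    ι (γ zero) * (m * 1#) + sum (λ i → ι (γ (suc i)) * (m * a * a ^ toℕ i))
      ≈⟨ +-congˡ (sum-cong-≋ {n} (λ i → *-congˡ (*-assoc m a _))) ⟩
    ι (γ zero) * (m * 1#) + sum (λ i → ι (γ (suc i)) * (m * (a * a ^ toℕ i)))
      ∎
    where E = eval (tabulate (γ ∘ suc)) a

  -- If m is nonzero and m, m a, ..., m aⁿ lie in a space spanned by n elements,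
  -- then a is algebraic.
  powersInSpan⇒¬transcendental : ∀ {n} {e : Fin n → Carrier} {a m} → m ≉ 0# →
    (∀ i → i ≤ n → m * a ^ i ∈ Span e) → ¬ Transcendental a
  powersInSpan⇒¬transcendental {n} {e} {a} {m} m≉0 h tr
    with dependent n (λ i → m * a ^ toℕ i) (λ i → h (toℕ i) (toℕ≤n i))
    where
    toℕ≤n : ∀ {n} (i : Fin (suc n)) → toℕ i ≤ n
    toℕ≤n         zero    = z≤n
    toℕ≤n {suc n} (suc i) = s≤s (toℕ≤n i)
  ... | γ , (k , γₖ≢0) , Σ≈0 = tr (tabulate γ) (tabulate⁺ {f = γ} k γₖ≢0)
    (*-cancelˡ-≉0 m≉0 (trans (eval-tabulate (suc n) γ a m) (trans Σ≈0 (sym (zeroʳ m)))))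

  -- The family 1, a, ..., a^(d-1).
  powers : Carrier → ∀ d → Fin d → Carrier
  powers a d i = a ^ toℕ i

  eval-zero : ∀ p a → ¬ NonZeroPolynomial p → eval p a ≈ 0#
  eval-zero []      a _  = refl
  eval-zero (q ∷ p) a ¬h = begin
    ι q + a * eval p a  ≈⟨ +-cong (trans (reflexive (≡.cong ι q≡0)) ι.0#-homo)
                             (*-congˡ (eval-zero p a (¬h ∘ there))) ⟩
    0# + a * 0#         ≈⟨ solve 1 (λ a → con 0ℚ :+ a :* con 0ℚ := con 0ℚ) refl a ⟩
    0#                  ∎
    where q≡0 = decidable-stable (q ℚ.≟ 0ℚ) (¬h ∘ here)

  -- Trailing zero coefficients are dropped: d is the degree of p, and q its
  -- leading coefficient.
  leadingTerm : ∀ p a → NonZeroPolynomial p →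
    ∃[ d ] ∃[ q ] ∃[ r ] (q ≢ 0ℚ × r ∈ Span (powers a d) × eval p a ≈ ι q * a ^ d + r)
  leadingTerm (q ∷ p) a nz with Any.any? (λ r → ¬? (r ℚ.≟ 0ℚ)) p
  ... | no p≡0 = 0 , q , 0# , head≢0 nz , null , (begin
    ι q + a * eval p a   ≈⟨ +-congˡ (*-congˡ (eval-zero p a p≡0)) ⟩
    ι q + a * 0#         ≈⟨ solve 2 (λ q a → q :+ a :* con 0ℚ := q :* con 1ℚ :+ con 0ℚ) refl (ι q) a ⟩
    ι q * 1# + 0#        ∎)
    where
    head≢0 : NonZeroPolynomial (q ∷ p) → q ≢ 0ℚ
    head≢0 (here q≢0)  = q≢0
    head≢0 (there p≢0) = contradiction p≢0 p≡0
  ... | yes p≢0 with leadingTerm p a p≢0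
  ... | d , l , r , l≢0 , r∈ , eq =
    suc d , l , ι q * 1# + a * r , l≢0 ,
    add (scale q (gen zero)) (span-mul a (λ i → gen (suc i)) r∈) , (begin
      ι q + a * eval p a                         ≈⟨ +-congˡ (*-congˡ eq) ⟩
      ι q + a * (ι l * a ^ d + r)                ≈⟨ solve 5 (λ q a l b r →
        q :+ a :* (l :* b :+ r) := l :* (a :* b) :+ (q :* con 1ℚ :+ a :* r))
        refl (ι q) a (ι l) (a ^ d) r ⟩
      ι l * (a * a ^ d) + (ι q * 1# + a * r)     ∎)

  -- A root of a nonzero polynomial has a power in the span of the lower ones.
  root⇒power∈span : ∀ p a → NonZeroPolynomial p → eval p a ≈ 0# →
    ∃[ d ] a ^ d ∈ Span (powers a d)
  root⇒power∈span p a nz p[a]≈0 with leadingTerm p a nz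
  ... | d , q , r , q≢0 , r∈ , eq = d , resp (begin
      ι (ℚ.1/ q) * - r
        ≈⟨ modulo (ι (ℚ.1/ q)) (trans (sym p[a]≈0) eq)
             (solve 4 (λ i q b r → i :* (:- r) := i :* q :* b :+ (con 0ℚ :- (q :* b :+ r)) :* i)
               refl (ι (ℚ.1/ q)) (ι q) (a ^ d) r) ⟩
      ι (ℚ.1/ q) * ι q * a ^ d
        ≈⟨ *-congʳ (ι.*-homo (ℚ.1/ q) q) ⟨
      ι (ℚ.1/ q ℚ.* q) * a ^ d
        ≈⟨ *-congʳ (trans (reflexive (≡.cong ι (ℚ.*-inverseˡ q))) ι.1#-homo) ⟩
      1# * a ^ d
        ≈⟨ *-identityˡ _ ⟩
      a ^ d
        ∎)
    (scale (ℚ.1/ q) (span-neg r∈))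
    where instance _ = ℚ.≢-nonZero q≢0

  power-step : ∀ {a d} → a ^ d ∈ Span (powers a d) → ∀ i → a * powers a d i ∈ Span (powers a d)
  power-step {a} {d} h i with successor i
  ... | inj₁ (j , eq) = resp (reflexive (≡.cong (a ^_) (≡.sym eq))) (gen j)
  ... | inj₂ eq       = resp (reflexive (≡.cong (a ^_) (≡.sym eq))) h

  1∈span-powers : ∀ {a} d → a ^ d ∈ Span (powers a d) → 1# ∈ Span (powers a d)
  1∈span-powers zero    h = h
  1∈span-powers (suc d) h = gen zero

  transcendental⇒≉0 : ∀ {a} → Transcendental a → a ≉ 0#
  transcendental⇒≉0 {a} tr a≈0 = tr (0ℚ ∷ 1ℚ ∷ []) (there (here λ ())) (begin
    ι 0ℚ + a * (ι 1ℚ + a * 0#)  ≈⟨ +-cong ι.0#-homo (*-congʳ a≈0) ⟩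
    0# + 0# * (ι 1ℚ + a * 0#)   ≈⟨ trans (+-identityˡ _) (zeroˡ _) ⟩
    0#                          ∎)

  -- Integral elements

  -- P contains 0 and 1 and is closed under the ring operations of K.  It is
  -- not required to respect the equality of K.
  record IsSubring {s} (P : Pred Carrier s) : Set (c ⊔ ℓ ⊔ s) where
    field
      0∈         : 0# ∈ P
      1∈         : 1# ∈ P
      +-closed   : ∀ {a b} → a ∈ P → b ∈ P → a + b ∈ P
      neg-closed : ∀ {a} → a ∈ P → - a ∈ P
      *-closed   : ∀ {a b} → a ∈ P → b ∈ P → a * b ∈ P

    sub-closed : ∀ {a b} → a ∈ P → b ∈ P → a - b ∈ P
    sub-closed a∈ b∈ = +-closed a∈ (neg-closed b∈)

    ·-closed : ∀ n {a} → a ∈ P → n · a ∈ P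
    ·-closed zero    a∈ = 0∈
    ·-closed (suc n) a∈ = +-closed a∈ (·-closed n a∈)

    ^-closed : ∀ n {a} → a ∈ P → a ^ n ∈ P
    ^-closed zero    a∈ = 1∈
    ^-closed (suc n) a∈ = *-closed a∈ (^-closed n a∈)

  -- The ring ℚ[y].
  data PolynomialIn (y : Carrier) : Pred Carrier (c ⊔ ℓ) where
    const : ∀ q → ι q ∈ PolynomialIn y
    var   : y ∈ PolynomialIn y
    add   : ∀ {a b} → a ∈ PolynomialIn y → b ∈ PolynomialIn y → a + b ∈ PolynomialIn y
    neg   : ∀ {a} → a ∈ PolynomialIn y → - a ∈ PolynomialIn y
    mul   : ∀ {a b} → a ∈ PolynomialIn y → b ∈ PolynomialIn y → a * b ∈ PolynomialIn y
    resp  : ∀ {a b} → a ≈ b → a ∈ PolynomialIn y → b ∈ PolynomialIn y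

  polynomials-isSubring : ∀ y → IsSubring (PolynomialIn y)
  polynomials-isSubring y = record
    { 0∈ = resp ι.0#-homo (const 0ℚ)
    ; 1∈ = resp ι.1#-homo (const 1ℚ)
    ; +-closed = add
    ; neg-closed = neg
    ; *-closed = mul
    }

  -- A monic equation of positive degree for x with coefficients in ℚ[y]; the
  -- coefficients are listed with the constant term first.
  record _IntegralOver_ (x y : Carrier) : Set (c ⊔ ℓ) where
    constructor integral
    field
      {degree-1}  : ℕ
      coefficient : Vec Carrier (suc degree-1)
      inℚ[y]      : All (PolynomialIn y) coefficient
      equation    : x ^ suc degree-1 ≈ sum (λ i → lookup coefficient i * x ^ toℕ i)

  span-mul-polynomial : ∀ {n} {e : Fin n → Carrier} {y} → (∀ i → y * e i ∈ Span e) →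
    ∀ {p} → p ∈ PolynomialIn y → ∀ {a} → a ∈ Span e → p * a ∈ Span e
  span-mul-polynomial h (const q) a∈ = scale q a∈
  span-mul-polynomial h var       a∈ = span-mul _ h a∈
  span-mul-polynomial h (add p q) a∈ =
    resp (sym (distribʳ _ _ _)) (add (span-mul-polynomial h p a∈) (span-mul-polynomial h q a∈))
  span-mul-polynomial h (neg {p} p∈) {a} a∈ =
    resp (solve 2 (λ p a → :- (p :* a) := (:- p) :* a) refl p a)
      (span-neg (span-mul-polynomial h p∈ a∈))
  span-mul-polynomial h (mul p q) a∈ =
    resp (sym (*-assoc _ _ _)) (span-mul-polynomial h p (span-mul-polynomial h q a∈))
  span-mul-polynomial h (resp p≈q p) a∈ = resp (*-congʳ p≈q) (span-mul-polynomial h p a∈)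

  -- The products of the powers of an algebraic y with those of x span a
  -- finite-dimensional space closed under multiplication by x.
  ¬transcendental-integralOver-algebraic : ∀ {x y} → x IntegralOver y →
    ∀ d → y ^ d ∈ Span (powers y d) → ¬ Transcendental x
  ¬transcendental-integralOver-algebraic {x} {y} (integral {k-1} q q∈ eq) d yᵈ∈ =
    powersInSpan⇒¬transcendental (0≉1 ∘ sym) (λ i _ → resp (sym (*-identityˡ _)) (xⁱ∈ i))
    where
    k = suc k-1
    e : Fin (d ℕ.* k) → Carrier
    e = uncurry (λ i j → y ^ toℕ i * x ^ toℕ j) ∘ remQuot {d} k

    monomial : ∀ i j → y ^ toℕ i * x ^ toℕ j ∈ Span e
    monomial i j = resp
      (reflexive (≡.cong (uncurry (λ i j → y ^ toℕ i * x ^ toℕ j)) (remQuot-combine {d} {k} i j)))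
      (gen (combine i j))

    monomial′ : ∀ (j : Fin k) i → x ^ toℕ j * powers y d i ∈ Span e
    monomial′ j i = resp (*-comm _ _) (monomial i j)

    closed-y : ∀ l → y * e l ∈ Span e
    closed-y l = resp
      (solve 3 (λ y a b → b :* (y :* a) := y :* (a :* b)) refl y (y ^ toℕ i) (x ^ toℕ j))
      (span-mul (x ^ toℕ j) (monomial′ j) (power-step yᵈ∈ i))
      where
      i = proj₁ (remQuot {d} k l)
      j = proj₂ (remQuot {d} k l)

    top : ∀ i → y ^ toℕ i * x ^ k ∈ Span e
    top i = resp (begin
        sum (λ j → lookup q j * (y ^ toℕ i * x ^ toℕ j))
          ≈⟨ sum-cong-≋ {k} (λ j → solve 3 (λ q a b → q :* (a :* b) := a :* (q :* b))
               refl (lookup q j) (y ^ toℕ i) (x ^ toℕ j)) ⟩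
        sum (λ j → y ^ toℕ i * (lookup q j * x ^ toℕ j))
          ≈⟨ *-distribˡ-sum {k} (y ^ toℕ i) (λ j → lookup q j * x ^ toℕ j) ⟨
        y ^ toℕ i * sum (λ j → lookup q j * x ^ toℕ j)
          ≈⟨ *-congˡ eq ⟨
        y ^ toℕ i * x ^ k
          ∎)
      (span-sum k _ (λ j → span-mul-polynomial closed-y (All.lookup⁺ q∈ j) (monomial i j)))

    closed-x : ∀ l → x * e l ∈ Span e
    closed-x l = resp
      (solve 3 (λ x a b → a :* (x :* b) := x :* (a :* b)) refl x (y ^ toℕ i) (x ^ toℕ j))
      (yⁱxʲ⁺¹∈ (successor j))
      where
      i = proj₁ (remQuot {d} k l)
      j = proj₂ (remQuot {d} k l)
      yⁱxʲ⁺¹∈ : (∃[ j′ ] suc (toℕ j) ≡ toℕ {k} j′) ⊎ suc (toℕ j) ≡ k →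
        y ^ toℕ i * x ^ suc (toℕ j) ∈ Span e
      yⁱxʲ⁺¹∈ (inj₁ (j′ , eq′)) =
        resp (*-congˡ (reflexive (≡.cong (x ^_) (≡.sym eq′)))) (monomial i j′)
      yⁱxʲ⁺¹∈ (inj₂ eq′) = resp (*-congˡ (reflexive (≡.cong (x ^_) (≡.sym eq′)))) (top i)

    xⁱ∈ : ∀ i → x ^ i ∈ Span e
    xⁱ∈ zero    = resp (*-identityˡ 1#) (span-mul 1# (monomial′ zero) (1∈span-powers d yᵈ∈))
    xⁱ∈ (suc i) = span-mul x closed-x (xⁱ∈ i)

  integral⇒transcendental : ∀ {x y} → x IntegralOver y → Transcendental x → Transcendental y
  integral⇒transcendental {x} {y} x-int tr p nz p[y]≈0 =
    uncurry (¬transcendental-integralOver-algebraic x-int) (root⇒power∈span p y nz p[y]≈0) tr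

  -- Integrality over the algebraic element 0 is integrality over ℚ.
  ¬transcendental-integralOver-0 : ∀ {x} → x IntegralOver 0# → ¬ Transcendental x
  ¬transcendental-integralOver-0 x-int tr =
    transcendental⇒≉0 (integral⇒transcendental x-int tr) refl

  -- The relation 1/v - v ≈ x

  -- The relation 1/v - v ≈ x without its denominator.
  _↝_ : Carrier → Carrier → Set ℓ
  v ↝ x = v * x ≈ 1# - v ^ 2

  1/-self⇒↝ : ∀ {v x} → 1/ v -self≈ x → v ↝ x
  1/-self⇒↝ {v} {x} (v≉0 , eq) = begin
    v * x                          ≈⟨ *-congˡ eq ⟨
    v * (1# * inv v v≉0 - v)       ≈⟨ modulo 1# (inverseʳ v v≉0)
      (solve 2 (λ v i → v :* (con 1ℚ :* i :- v)
         := con 1ℚ :- v :^ 2 :+ (v :* i :- con 1ℚ) :* con 1ℚ) refl v (inv v v≉0)) ⟩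
    1# - v ^ 2                     ∎

  ↝⇒1/-self : ∀ {v x} → v ≉ 0# → v ↝ x → 1/ v -self≈ x
  ↝⇒1/-self {v} {x} v≉0 eq = v≉0 , *-cancelˡ-≉0 v≉0 (begin
    v * (1# * inv v v≉0 - v)       ≈⟨ 1/-self⇒↝ (v≉0 , refl) ⟩
    1# - v ^ 2                     ≈⟨ eq ⟨
    v * x                          ∎)

  ↝⇒integral : ∀ {v x} → v ↝ x → v IntegralOver x
  ↝⇒integral {v} {x} eq = integral (1# ∷ - x ∷ []) (1∈ ∷ neg var ∷ [])
    (modulo 1# eq (solve 2 (λ v x →
      v :^ 2 := con 1ℚ :* v :^ 0 :+ ((:- x) :* v :^ 1 :+ con 0ℚ)
        :+ (v :* x :- (con 1ℚ :- v :^ 2)) :* con 1ℚ) refl v x))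
    where open IsSubring (polynomials-isSubring x)

  -- If v is algebraic, so is x: in the space spanned by the powers of v lie
  -- all vⁿ xⁱ with i ≤ n, since v x is a polynomial in v.
  ↝⇒transcendental : ∀ {v x} → v ≉ 0# → v ↝ x → Transcendental x → Transcendental v
  ↝⇒transcendental {v} {x} v≉0 eq tr p nz p[v]≈0 =
    uncurry ¬transcendental (root⇒power∈span p v nz p[v]≈0) tr
    where
    open IsSubring (polynomials-isSubring v)
    ¬transcendental : ∀ d → v ^ d ∈ Span (powers v d) → ¬ Transcendental x
    ¬transcendental d vᵈ∈ = powersInSpan⇒¬transcendental (^-≉0 d v≉0) (vⁿxⁱ∈ d)
      where
      vⁿ∈ : ∀ n → v ^ n ∈ Span (powers v d)
      vⁿ∈ zero    = 1∈span-powers d vᵈ∈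
      vⁿ∈ (suc n) = span-mul v (power-step vᵈ∈) (vⁿ∈ n)

      vⁿxⁱ∈ : ∀ n i → i ≤ n → v ^ n * x ^ i ∈ Span (powers v d)
      vⁿxⁱ∈ n       zero    _         = resp (sym (*-identityʳ _)) (vⁿ∈ n)
      vⁿxⁱ∈ (suc n) (suc i) (s≤s i≤n) = resp (begin
          (1# - v ^ 2) * (v ^ n * x ^ i)  ≈⟨ *-congʳ eq ⟨
          v * x * (v ^ n * x ^ i)         ≈⟨ solve 4 (λ v x a b →
            v :* x :* (a :* b) := v :* a :* (x :* b)) refl v x (v ^ n) (x ^ i) ⟩
          v * v ^ n * (x * x ^ i)         ∎)
        (span-mul-polynomial (power-step vᵈ∈) (sub-closed 1∈ (^-closed 2 var)) (vⁿxⁱ∈ n i i≤n))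

  -- Both recursive equations preserve transcendence

  -- The left-hand side of (E), and the coefficient of w in the reduction of w⁵
  -- modulo w² + y w - 1.
  quintic quartic : Carrier → Carrier
  quintic y = y ^ 5 + 5 · y ^ 3 + 5 · y - 11 · 1#
  quartic y = y ^ 4 + 3 · y ^ 2 + 1#

  -- The same expressions in the syntax of the ring solver.
  denEᵖ numLᵖ denLᵖ quinticᵖ quarticᵖ : ∀ {n} → Polynomial n → Polynomial n
  denEᵖ x = x :^ 4 :+ x :^ 3 :+ 6 :× x :^ 2 :+ 6 :× x :+ 11 :× con 1ℚ
  numLᵖ x = x :^ 4 :- 3 :× x :^ 3 :+ 4 :× x :^ 2 :- 2 :× x :+ con 1ℚ
  denLᵖ x = x :^ 4 :+ 2 :× x :^ 3 :+ 4 :× x :^ 2 :+ 3 :× x :+ con 1ℚ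
  quinticᵖ y = y :^ 5 :+ 5 :× y :^ 3 :+ 5 :× y :- 11 :× con 1ℚ
  quarticᵖ y = y :^ 4 :+ 3 :× y :^ 2 :+ con 1ℚ

  -- Cleared of denominators, (E) is (x - 1)⁵ = t d(x) with t the left-hand side
  -- and d(x) the denominator of its right-hand side, which has degree 4.
  EqE⇒integral : ∀ {x y} → EqE x y → x IntegralOver y
  EqE⇒integral {x} {y} (d≉0 , eq) = integral
    (1# + 11 · t ∷ 6 · t - 5 · 1# ∷ 10 · 1# + 6 · t ∷ t - 10 · 1# ∷ 5 · 1# + t ∷ [])
    ( +-closed 1∈ (·-closed 11 t∈) ∷ sub-closed (·-closed 6 t∈) (·-closed 5 1∈)
    ∷ +-closed (·-closed 10 1∈) (·-closed 6 t∈) ∷ sub-closed t∈ (·-closed 10 1∈)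
    ∷ +-closed (·-closed 5 1∈) t∈ ∷ [])
    (modulo (- 1#) (≈/⇒*≈ d≉0 eq) (solve 2 (λ x t → x :^ 5 :=
      (con 1ℚ :+ 11 :× t) :* x :^ 0 :+ ((6 :× t :- 5 :× con 1ℚ) :* x :^ 1
        :+ ((10 :× con 1ℚ :+ 6 :× t) :* x :^ 2 :+ ((t :- 10 :× con 1ℚ) :* x :^ 3
        :+ ((5 :× con 1ℚ :+ t) :* x :^ 4 :+ con 0ℚ))))
      :+ (t :* denEᵖ x :- (x :- con 1ℚ) :^ 5) :* (:- con 1ℚ)) refl x t))
    where
    open IsSubring (polynomials-isSubring y)
    t = quintic y
    t∈ : t ∈ PolynomialIn y
    t∈ = sub-closed (+-closed (+-closed (^-closed 5 var) (·-closed 5 (^-closed 3 var)))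
      (·-closed 5 var)) (·-closed 11 1∈)

  EqL⇒*≈ : ∀ {v w} → EqL v w → w ^ 5 * denL v ≈ v * numL v
  EqL⇒*≈ (d≉0 , eq) = ≈/⇒*≈ d≉0 (trans eq (sym (*-assoc _ _ _)))

  EqL⇒integral : ∀ {v w} → EqL v w → v IntegralOver w
  EqL⇒integral {v} {w} eqL = integral
    (s ∷ 3 · s - 1# ∷ 2 · 1# + 4 · s ∷ 2 · s - 4 · 1# ∷ 3 · 1# + s ∷ [])
    ( s∈ ∷ sub-closed (·-closed 3 s∈) 1∈
    ∷ +-closed (·-closed 2 1∈) (·-closed 4 s∈) ∷ sub-closed (·-closed 2 s∈) (·-closed 4 1∈)
    ∷ +-closed (·-closed 3 1∈) s∈ ∷ [])
    (modulo (- 1#) (EqL⇒*≈ eqL) (solve 2 (λ v s → v :^ 5 :=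
      s :* v :^ 0 :+ ((3 :× s :- con 1ℚ) :* v :^ 1
        :+ ((2 :× con 1ℚ :+ 4 :× s) :* v :^ 2 :+ ((2 :× s :- 4 :× con 1ℚ) :* v :^ 3
        :+ ((3 :× con 1ℚ :+ s) :* v :^ 4 :+ con 0ℚ))))
      :+ (s :* denLᵖ v :- v :* numLᵖ v) :* (:- con 1ℚ)) refl v s))
    where
    open IsSubring (polynomials-isSubring w)
    s = w ^ 5
    s∈ : s ∈ PolynomialIn w
    s∈ = ^-closed 5 var

  quartic-≉0 : ∀ {y} → Transcendental y → quartic y ≉ 0#
  quartic-≉0 {y} tr q≈0 = ¬transcendental-integralOver-0 (integral
    (- 1# ∷ 0# ∷ - (3 · 1#) ∷ 0# ∷ [])
    (neg 1∈ ∷ 0∈ ∷ neg (·-closed 3 1∈) ∷ 0∈ ∷ [])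
    (modulo 1# q≈0 (solve 1 (λ y → y :^ 4 :=
      (:- con 1ℚ) :* y :^ 0 :+ (con 0ℚ :* y :^ 1 :+ ((:- (3 :× con 1ℚ)) :* y :^ 2
        :+ (con 0ℚ :* y :^ 3 :+ con 0ℚ)))
      :+ (quarticᵖ y :- con 0ℚ) :* con 1ℚ) refl y))) tr
    where open IsSubring (polynomials-isSubring 0#)

  numL-≉0 : ∀ {v} → Transcendental v → numL v ≉ 0#
  numL-≉0 {v} tr n≈0 = ¬transcendental-integralOver-0 (integral
    (- 1# ∷ 2 · 1# ∷ - (4 · 1#) ∷ 3 · 1# ∷ [])
    (neg 1∈ ∷ ·-closed 2 1∈ ∷ neg (·-closed 4 1∈) ∷ ·-closed 3 1∈ ∷ [])
    (modulo 1# n≈0 (solve 1 (λ v → v :^ 4 :=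
      (:- con 1ℚ) :* v :^ 0 :+ ((2 :× con 1ℚ) :* v :^ 1 :+ ((:- (4 :× con 1ℚ)) :* v :^ 2
        :+ ((3 :× con 1ℚ) :* v :^ 3 :+ con 0ℚ)))
      :+ (numLᵖ v :- con 0ℚ) :* con 1ℚ) refl v))) tr
    where open IsSubring (polynomials-isSubring 0#)

  -- Modular identities

  denE-factors : ∀ {v x} → v ↝ x → v ^ 4 * denE x ≈ numL v * denL v
  denE-factors {v} {x} eq = begin
    v ^ 4 * denE x      ≈⟨ solve 2 (λ v x → v :^ 4 :* denEᵖ x := Hᵖ (v :* x) v) refl v x ⟩
    H (v * x)           ≈⟨ H-cong eq ⟩
    H (1# - v ^ 2)      ≈⟨ solve 1 (λ v → Hᵖ (con 1ℚ :- v :^ 2) v := numLᵖ v :* denLᵖ v) refl v ⟩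
    numL v * denL v     ∎
    where
    -- The denominator of (E) made homogeneous.
    H : Carrier → Carrier
    H z = z ^ 4 + z ^ 3 * v + 6 · (z ^ 2 * v ^ 2) + 6 · (z * v ^ 3) + 11 · v ^ 4
    Hᵖ : ∀ {n} → Polynomial n → Polynomial n → Polynomial n
    Hᵖ z v = z :^ 4 :+ z :^ 3 :* v :+ 6 :× (z :^ 2 :* v :^ 2) :+ 6 :× (z :* v :^ 3) :+ 11 :× v :^ 4
    H-cong : ∀ {z z′} → z ≈ z′ → H z ≈ H z′
    H-cong e = +-congʳ (+-cong (+-cong (+-cong (^-congˡ 4 e) (*-congʳ (^-congˡ 3 e)))
      (×-congʳ 6 (*-congʳ (^-congˡ 2 e)))) (×-congʳ 6 (*-congʳ e)))

  numE-factors : ∀ {v x} → v ↝ x → v ^ 5 * (x - 1#) ^ 5 ≈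
    denL v ^ 2 - (v * numL v) ^ 2 - 11 · (v * numL v * denL v)
  numE-factors {v} {x} eq = begin
    v ^ 5 * (x - 1#) ^ 5   ≈⟨ solve 2 (λ v x → v :^ 5 :* (x :- con 1ℚ) :^ 5 := (v :* x :- v) :^ 5) refl v x ⟩
    (v * x - v) ^ 5        ≈⟨ ^-congˡ 5 (+-congʳ eq) ⟩
    (1# - v ^ 2 - v) ^ 5   ≈⟨ solve 1 (λ v → (con 1ℚ :- v :^ 2 :- v) :^ 5 :=
      denLᵖ v :^ 2 :- (v :* numLᵖ v) :^ 2 :- 11 :× (v :* numLᵖ v :* denLᵖ v)) refl v ⟩
    denL v ^ 2 - (v * numL v) ^ 2 - 11 · (v * numL v * denL v) ∎

  -- With u the right-hand side of (L) at v, the right-hand side of (E) at x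
  -- is 1/u - u - 11.
  rhsE-rhsL : ∀ {v x u} → v ↝ x → u * denL v ≈ v * numL v →
    v ^ 5 * denE x * (1# - u ^ 2 - 11 · u) ≈ v ^ 5 * (x - 1#) ^ 5 * u
  rhsE-rhsL {v} {x} {u} eq uL≈vN = begin
    v ^ 5 * denE x * (1# - u ^ 2 - 11 · u)
      ≈⟨ solve 3 (λ v d a → v :^ 5 :* d :* a := v :* (v :^ 4 :* d) :* a) refl v (denE x) _ ⟩
    v * (v ^ 4 * denE x) * (1# - u ^ 2 - 11 · u)
      ≈⟨ *-congʳ (*-congˡ (denE-factors eq)) ⟩
    v * (N * L) * (1# - u ^ 2 - 11 · u)
      ≈⟨ modulo (- (L + v * N * u)) uL≈vN (solve 4 (λ v N L u →
           v :* (N :* L) :* (con 1ℚ :- u :^ 2 :- 11 :× u)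
             := (L :^ 2 :- (v :* N) :^ 2 :- 11 :× (v :* N :* L)) :* u
                :+ (u :* L :- v :* N) :* (:- (L :+ v :* N :* u))) refl v N L u) ⟩
    (L ^ 2 - (v * N) ^ 2 - 11 · (v * N * L)) * u
      ≈⟨ *-congʳ (numE-factors eq) ⟨
    v ^ 5 * (x - 1#) ^ 5 * u
      ∎
    where
    N = numL v
    L = denL v

  -- The left-hand side of (E) at 1/w - w is 1/w⁵ - w⁵ - 11.
  lhsE-fifthPower : ∀ {w y} → w ↝ y →
    quintic y * w ^ 5 ≈ 1# - (w ^ 5) ^ 2 - 11 · w ^ 5
  lhsE-fifthPower {w} {y} eq = begin
    quintic y * w ^ 5    ≈⟨ solve 2 (λ w y → quinticᵖ y :* w :^ 5 := Hᵖ (w :* y) w) refl w y ⟩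
    H (w * y)            ≈⟨ H-cong eq ⟩
    H (1# - w ^ 2)       ≈⟨ solve 1 (λ w → Hᵖ (con 1ℚ :- w :^ 2) w :=
      con 1ℚ :- (w :^ 5) :^ 2 :- 11 :× w :^ 5) refl w ⟩
    1# - (w ^ 5) ^ 2 - 11 · w ^ 5   ∎
    where
    -- The left-hand side of (E) made homogeneous.
    H : Carrier → Carrier
    H z = z ^ 5 + 5 · (z ^ 3 * w ^ 2) + 5 · (z * w ^ 4) - 11 · w ^ 5
    Hᵖ : ∀ {n} → Polynomial n → Polynomial n → Polynomial n
    Hᵖ z w = z :^ 5 :+ 5 :× (z :^ 3 :* w :^ 2) :+ 5 :× (z :* w :^ 4) :- 11 :× w :^ 5
    H-cong : ∀ {z z′} → z ≈ z′ → H z ≈ H z′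
    H-cong e = +-congʳ (+-cong (+-cong (^-congˡ 5 e) (×-congʳ 5 (*-congʳ (^-congˡ 3 e))))
      (×-congʳ 5 (*-congʳ e)))

  -- One step of the towers

  EqL⇒EqE : ∀ {v w x y} → Transcendental v → EqL v w →
    1/ v -self≈ x → 1/ w -self≈ y → EqE x y
  EqL⇒EqE {v} {w} {x} {y} tr eqL@(denL≉0 , _) v↝x w↝y =
    denE≉0 , *≈⇒≈/ denE≉0 (*-cancelˡ-≉0 (*-≉0 (^-≉0 5 v≉0) (^-≉0 5 w≉0)) (begin
      v ^ 5 * w ^ 5 * (quintic y * denE x)
        ≈⟨ solve 4 (λ a u p d → a :* u :* (p :* d) := a :* d :* (p :* u))
             refl (v ^ 5) (w ^ 5) (quintic y) (denE x) ⟩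
      v ^ 5 * denE x * (quintic y * w ^ 5)
        ≈⟨ *-congˡ (lhsE-fifthPower (1/-self⇒↝ w↝y)) ⟩
      v ^ 5 * denE x * (1# - (w ^ 5) ^ 2 - 11 · w ^ 5)
        ≈⟨ rhsE-rhsL (1/-self⇒↝ v↝x) (EqL⇒*≈ eqL) ⟩
      v ^ 5 * (x - 1#) ^ 5 * w ^ 5
        ≈⟨ solve 3 (λ a b u → a :* b :* u := a :* u :* b) refl (v ^ 5) ((x - 1#) ^ 5) (w ^ 5) ⟩
      v ^ 5 * w ^ 5 * (x - 1#) ^ 5
        ∎))
    where
    v≉0 = proj₁ v↝x
    w≉0 = proj₁ w↝y
    denE≉0 : denE x ≉ 0#
    denE≉0 = *-≉0⁻ʳ (≈-≉0 (denE-factors (1/-self⇒↝ v↝x)) (*-≉0 (numL-≉0 tr) denL≉0))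

  adjoin-isSubring : ∀ {s} (S : Pred Carrier s) → IsSubring ℚ⟨ S ⟩
  adjoin-isSubring S = record
    { 0∈ = resp ι.0#-homo (const 0ℚ)
    ; 1∈ = resp ι.1#-homo (const 1ℚ)
    ; +-closed = add
    ; neg-closed = neg
    ; *-closed = mul
    }

  -- Reducing w⁵ = u modulo w² + y w - 1 gives the linear equation
  -- (y⁴ + 3 y² + 1) w = u + y³ + 2 y, by which w is defined here.
  step : ∀ x y v → Transcendental x → EqE x y → 1/ v -self≈ x →
    ∃[ w ] (w ∈ ℚ[ v , y ] × 1/ w -self≈ y × EqL v w)
  step x y v tr eqE@(denE≉0 , eq) v↝x =
    w , w∈ , ↝⇒1/-self w≉0 w↝y , denL≉0 , w⁵≈u
    where
    open IsSubring (adjoin-isSubring (λ e → e ≈ v ⊎ e ≈ y))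
    v≉0 = proj₁ v↝x
    vx≈ = 1/-self⇒↝ v↝x

    D≉0 : quartic y ≉ 0#
    D≉0 = quartic-≉0 (integral⇒transcendental (EqE⇒integral eqE) tr)
    denL≉0 : denL v ≉ 0#
    denL≉0 = *-≉0⁻ʳ (≈-≉0 (sym (denE-factors vx≈)) (*-≉0 (^-≉0 4 v≉0) denE≉0))

    u a w : Carrier
    u = v * (numL v / denL v [ denL≉0 ])
    a = u + (y ^ 3 + 2 · y)
    w = a / quartic y [ D≉0 ]

    u-equation : quintic y * u ≈ 1# - u ^ 2 - 11 · u
    u-equation = *-cancelˡ-≉0 (*-≉0 (^-≉0 5 v≉0) denE≉0) (begin
      v ^ 5 * denE x * (quintic y * u)
        ≈⟨ solve 4 (λ a d p u → a :* d :* (p :* u) := a :* (p :* d) :* u)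
             refl (v ^ 5) (denE x) (quintic y) u ⟩
      v ^ 5 * (quintic y * denE x) * u
        ≈⟨ *-congʳ (*-congˡ (≈/⇒*≈ denE≉0 eq)) ⟩
      v ^ 5 * (x - 1#) ^ 5 * u
        ≈⟨ rhsE-rhsL vx≈ (≈/⇒*≈ denL≉0 (sym (*-assoc _ _ _))) ⟨
      v ^ 5 * denE x * (1# - u ^ 2 - 11 · u)
        ∎)

    w*D≈a : w * quartic y ≈ a
    w*D≈a = /-*-cancel a D≉0

    w↝y : w ↝ y
    w↝y = *-cancelˡ-≉0 (^-≉0 2 D≉0) (begin
      D ^ 2 * (w * y)
        ≈⟨ solve 3 (λ D w y → D :^ 2 :* (w :* y) := w :* D :* (D :* y)) refl D w y ⟩
      w * D * (D * y)
        ≈⟨ *-congʳ w*D≈a ⟩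
      a * (D * y)
        ≈⟨ modulo 1# u-equation (solve 2 (λ u y →
             let a = u :+ (y :^ 3 :+ 2 :× y); D = quarticᵖ y in
             a :* (D :* y) := D :^ 2 :- a :^ 2
               :+ (quinticᵖ y :* u :- (con 1ℚ :- u :^ 2 :- 11 :× u)) :* con 1ℚ) refl u y) ⟩
      D ^ 2 - a ^ 2
        ≈⟨ +-congˡ (-‿cong (^-congˡ 2 w*D≈a)) ⟨
      D ^ 2 - (w * D) ^ 2
        ≈⟨ solve 2 (λ D w → D :^ 2 :- (w :* D) :^ 2 := D :^ 2 :* (con 1ℚ :- w :^ 2)) refl D w ⟩
      D ^ 2 * (1# - w ^ 2)
        ∎)
      where D = quartic y

    w≉0 : w ≉ 0#
    -- w (w + y) = 1.
    w≉0 = *-≉0⁻ˡ (≈-≉0 (modulo {w * (w + y)} {1#} 1# w↝y (solve 2 (λ w y →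
      w :* (w :+ y) := con 1ℚ :+ (w :* y :- (con 1ℚ :- w :^ 2)) :* con 1ℚ) refl w y)) (0≉1 ∘ sym))

    w⁵≈u : w ^ 5 ≈ u
    w⁵≈u = begin
      w ^ 5
        -- The cofactor is the quotient of w⁵ by w² + y w - 1.
        ≈⟨ modulo (w ^ 3 - y * w ^ 2 + (1# + y ^ 2) * w - (2 · y + y ^ 3)) w↝y
             (solve 2 (λ w y → w :^ 5 := w :* quarticᵖ y :- (y :^ 3 :+ 2 :× y)
               :+ (w :* y :- (con 1ℚ :- w :^ 2))
                  :* (w :^ 3 :- y :* w :^ 2 :+ (con 1ℚ :+ y :^ 2) :* w :- (2 :× y :+ y :^ 3)))
               refl w y) ⟩
      w * quartic y - (y ^ 3 + 2 · y)
        ≈⟨ +-congʳ w*D≈a ⟩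
      u + (y ^ 3 + 2 · y) - (y ^ 3 + 2 · y)
        ≈⟨ solve 2 (λ u b → u :+ b :- b := u) refl u _ ⟩
      u
        ∎

    v∈ : v ∈ ℚ[ v , y ]
    v∈ = gen (inj₁ refl)
    y∈ : y ∈ ℚ[ v , y ]
    y∈ = gen (inj₂ refl)
    numL∈ : numL v ∈ ℚ[ v , y ]
    numL∈ = +-closed (sub-closed (+-closed (sub-closed (^-closed 4 v∈) (·-closed 3 (^-closed 3 v∈)))
      (·-closed 4 (^-closed 2 v∈))) (·-closed 2 v∈)) 1∈
    denL∈ : denL v ∈ ℚ[ v , y ]
    denL∈ = +-closed (+-closed (+-closed (+-closed (^-closed 4 v∈) (·-closed 2 (^-closed 3 v∈)))
      (·-closed 4 (^-closed 2 v∈))) (·-closed 3 v∈)) 1∈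
    w∈ : w ∈ ℚ[ v , y ]
    w∈ = *-closed
      (+-closed (*-closed v∈ (*-closed numL∈ (recip denL≉0 denL∈)))
        (+-closed (^-closed 3 y∈) (·-closed 2 y∈)))
      (recip D≉0 (+-closed (+-closed (^-closed 4 y∈) (·-closed 3 (^-closed 2 y∈))) 1∈))

  -- Towers

  adjoin-least : ∀ {s t} {S : Pred Carrier s} {T : Pred Carrier t} →
    S ⊆ ℚ⟨ T ⟩ → ℚ⟨ S ⟩ ⊆ ℚ⟨ T ⟩
  adjoin-least h (gen a∈)       = h a∈
  adjoin-least h (const q)      = const q
  adjoin-least h (add a∈ b∈)    = add (adjoin-least h a∈) (adjoin-least h b∈)
  adjoin-least h (neg a∈)       = neg (adjoin-least h a∈)
  adjoin-least h (mul a∈ b∈)    = mul (adjoin-least h a∈) (adjoin-least h b∈)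
  adjoin-least h (recip a≉0 a∈) = recip a≉0 (adjoin-least h a∈)
  adjoin-least h (resp a≈b a∈)  = resp a≈b (adjoin-least h a∈)

  -- Since xᵢ = 1/vᵢ - vᵢ, each xᵢ lies in the field generated by vᵢ.
  ℚ[]≤-mono : ∀ {x v} → (∀ i → 1/ v i -self≈ x i) → ∀ n → ℚ[ x ]≤ n ⊆ ℚ[ v ]≤ n
  ℚ[]≤-mono {x} {v} h n = adjoin-least xᵢ∈
    where
    open IsSubring (adjoin-isSubring (λ e → ∃[ i ] (i ≤ n × e ≈ v i)))
    xᵢ∈ : (λ e → ∃[ i ] (i ≤ n × e ≈ x i)) ⊆ ℚ[ v ]≤ n
    xᵢ∈ (i , i≤n , a≈xᵢ) =
      resp (trans (proj₂ (h i)) (sym a≈xᵢ)) (sub-closed (*-closed 1∈ (recip (proj₁ (h i)) vᵢ∈)) vᵢ∈)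
      where vᵢ∈ = gen (i , i≤n , refl)

  towerE⇒supertowerL : ∀ x F → RecursiveTower EqE x F → ∀ v₀ → 1/ v₀ -self≈ x 0 →
    ∃[ v ] ∃[ G ] (v 0 ≈ v₀ × RecursiveTower EqL v G ×
      (∀ i → 1/ v i -self≈ x i) × G IsSupertowerOf F)
  towerE⇒supertowerL x F tower v₀ v₀↝x₀ =
    v , ℚ[ v ]≤_ , refl , record
      { transcendental = ↝⇒transcendental (proj₁ v₀↝x₀) (1/-self⇒↝ v₀↝x₀) transcendental
      ; recursion      = λ i → proj₂ (proj₂ (proj₂ (next i)))
      ; generated      = λ n → (λ a∈ → a∈) , (λ a∈ → a∈)
      } , v↝x , λ n a∈ → ℚ[]≤-mono v↝x n (proj₁ (generated n) a∈)
    where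
    open RecursiveTower tower
    x-transcendental : ∀ i → Transcendental (x i)
    x-transcendental zero    = transcendental
    x-transcendental (suc i) =
      integral⇒transcendental (EqE⇒integral (recursion i)) (x-transcendental i)

    vs : ∀ i → Σ[ a ∈ Carrier ] 1/ a -self≈ x i
    next : ∀ i → ∃[ w ] (w ∈ ℚ[ proj₁ (vs i) , x (suc i) ] ×
      1/ w -self≈ x (suc i) × EqL (proj₁ (vs i)) w)
    vs zero    = v₀ , v₀↝x₀
    vs (suc i) = proj₁ (next i) , proj₁ (proj₂ (proj₂ (next i)))
    next i = step (x i) (x (suc i)) (proj₁ (vs i)) (x-transcendental i) (recursion i) (proj₂ (vs i))

    v : ℕ → Carrier
    v i = proj₁ (vs i)
    v↝x : ∀ i → 1/ v i -self≈ x i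
    v↝x i = proj₂ (vs i)

  towerL⇒subtowerE : ∀ v G → RecursiveTower EqL v G →
    ∃[ x ] ∃[ F ] ((∀ i → 1/ v i -self≈ x i) × RecursiveTower EqE x F ×
      G IsSupertowerOf F)
  towerL⇒subtowerE v G tower =
    x , ℚ[ x ]≤_ , v↝x , record
      { transcendental = integral⇒transcendental (↝⇒integral (1/-self⇒↝ (v↝x 0))) transcendental
      ; recursion      = λ i → EqL⇒EqE (v-transcendental i) (recursion i) (v↝x i) (v↝x (suc i))
      ; generated      = λ n → (λ a∈ → a∈) , (λ a∈ → a∈)
      } , λ n a∈ → proj₂ (generated n) (ℚ[]≤-mono v↝x n a∈)
    where
    open RecursiveTower tower
    v-transcendental : ∀ i → Transcendental (v i)
    v-transcendental zero    = transcendental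
    v-transcendental (suc i) =
      integral⇒transcendental (EqL⇒integral (recursion i)) (v-transcendental i)

    v≉0 : ∀ i → v i ≉ 0#
    v≉0 i = transcendental⇒≉0 (v-transcendental i)
    x : ℕ → Carrier
    x i = 1# / v i [ v≉0 i ] - v i
    v↝x : ∀ i → 1/ v i -self≈ x i
    v↝x i = v≉0 i , refl

mainTheorem3 : ∀ {c ℓ} (K : FieldExtensionOfℚ c ℓ) → let open OverℚIn K in
    (∀ x y v → Transcendental x → EqE x y → 1/ v -self≈ x →
    ∃[ w ] (w ∈ ℚ[ v , y ] × 1/ w -self≈ y × EqL v w))
    ×
    (∀ x F → RecursiveTower EqE x F → ∀ v₀ → 1/ v₀ -self≈ x 0 →
    ∃[ v ] ∃[ G ] (v 0 ≈ v₀ × RecursiveTower EqL v G ×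
    (∀ i → 1/ v i -self≈ x i) × G IsSupertowerOf F))
    ×
    (∀ v G → RecursiveTower EqL v G →
    ∃[ x ] ∃[ F ] ((∀ i → 1/ v i -self≈ x i) × RecursiveTower EqE x F ×
    G IsSupertowerOf F))
mainTheorem3 K = step , towerE⇒supertowerL , towerL⇒subtowerE
  where open Extension K
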